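{- Let $G$ be a finite simple graph with vertex set $V(G)$ and let $\varepsilon\in\mathbb F_2^{V(G)}$. Put $M(G,\varepsilon)=A(G)+D_\varepsilon$. Then the equation \[ M(G,\varepsilon)x=\varepsilon \] has a solution $x\in\mathbb F_2^{V(G)}$. Moreover, every solution $x$ satisfies \[ \varepsilon^T x\equiv \operatorname{rank}(M(G,\varepsilon))\pmod 2 . \]
   Context: All matrices and vector spaces are over the two-element field $\mathbb F_2$. $A(G)$ is the adjacency matrix of $G$ over $\mathbb F_2$, and $D_\varepsilon$ is the diagonal matrix with diagonal vector $\varepsilon$. A congruence modulo 2 between an element of $\mathbb F_2$ and an integer means that the element equals the image of the integer in $\mathbb F_2$. -}

module Defs where

open import Algebra.Properties.CommutativeMonoid.Sum using (sum)
open import Data.Bool.Base using (if_then_else_)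
open import Data.Fin.Base using (Fin; zero; suc)
open import Data.Fin.Properties using (all?) renaming (_≟_ to _≟ᶠ_)
open import Data.Fin.Subset using (Subset; inside; outside; _∉_; ∣_∣)
open import Data.Fin.Subset.Properties using (_∈?_)
open import Data.List.Base using (List; []; _∷_; _++_; map; filter)
open import Data.List.Extrema.Nat using (max)
open import Data.Nat.Base using (ℕ; zero; suc)
open import Data.Parity.Base using (Parity; 0ℙ; 1ℙ; _+_; _*_)
open import Data.Parity.Properties using (_≟_; +-0-commutativeMonoid)
import Data.Vec.Base as Vec
open import Data.Vec.Functional as Vector using (Vector)
open import Level using (Level) renaming (suc to lsuc)
open import Relation.Binary.Core using (Rel)
open import Relation.Binary.Definitions using (Decidable; Symmetric; Irreflexive)
open import Relation.Binary.PropositionalEquality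
  using (_≡_; _≗_; refl; sym; trans)
open import Relation.Nullary.Decidable using (Dec; yes; no; does; map′; _→-dec_; ¬?)
open import Relation.Unary using (Pred) renaming (Decidable to Decidable₁)

-- Parity, with 0ℙ and 1ℙ, is used as the field of two elements; the image of
-- an integer n ≥ 0 in it is `parity n`.

Matrix : ℕ → ℕ → Set
Matrix m n = Fin m → Fin n → Parity

infixl 8 _·_
_·_ : ∀ {n} → Vector Parity n → Vector Parity n → Parity
u · v = sum +-0-commutativeMonoid (λ i → u i * v i)

infixr 8 _*ᵥ_
_*ᵥ_ : ∀ {m n} → Matrix m n → Vector Parity n → Vector Parity m
(M *ᵥ x) i = M i · x

infixl 7 _+ᴹ_
_+ᴹ_ : ∀ {m n} → Matrix m n → Matrix m n → Matrix m n
(M +ᴹ N) i j = M i j + N i j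

diagonal : ∀ {n} → Vector Parity n → Matrix n n
diagonal d i j = if does (i ≟ᶠ j) then d i else 0ℙ

zeroᵥ : ∀ {n} → Vector Parity n
zeroᵥ _ = 0ℙ

-- The columns of M with index in S are linearly independent: M *ᵥ c is the
-- combination of the columns with coefficients c, and c is supported on S.
ColumnsIndependent : ∀ {m n} → Matrix m n → Subset n → Set
ColumnsIndependent {n = n} M S =
  (c : Vector Parity n) → (∀ j → j ∉ S → c j ≡ 0ℙ) → M *ᵥ c ≗ zeroᵥ → c ≗ zeroᵥ

·-congʳ : ∀ {n} (u : Vector Parity n) {v w : Vector Parity n} →
          v ≗ w → u · v ≡ u · w
·-congʳ {zero}  u v≗w = refl
·-congʳ {suc n} u v≗w
  rewrite v≗w zero | ·-congʳ (λ i → u (suc i)) (λ i → v≗w (suc i)) = refl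

allVectors? : ∀ {p n} {P : Pred (Vector Parity n) p} →
              (∀ {v w} → v ≗ w → P v → P w) →
              Decidable₁ P → Dec (∀ v → P v)
allVectors? {n = zero} resp P? =
  map′ (λ p v → resp (λ ()) p) (λ p → p Vector.[]) (P? Vector.[])
allVectors? {n = suc n} {P} resp P?
  with allVectors? (resp∷ 0ℙ) (λ v → P? (0ℙ Vector.∷ v))
     | allVectors? (resp∷ 1ℙ) (λ v → P? (1ℙ Vector.∷ v))
  where
  resp∷ : ∀ a {v w : Vector Parity n} → v ≗ w →
          P (a Vector.∷ v) → P (a Vector.∷ w)
  resp∷ a v≗w = resp λ { zero → refl ; (suc i) → v≗w i }
... | no ¬p₀ | _      = no λ p → ¬p₀ λ v → p _
... | yes _  | no ¬p₁ = no λ p → ¬p₁ λ v → p _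
... | yes p₀ | yes p₁ = yes all
  where
  all : ∀ v → P v
  all v with v zero in eq
  ... | 0ℙ = resp (λ { zero → sym eq ; (suc i) → refl }) (p₀ (Vector.tail v))
  ... | 1ℙ = resp (λ { zero → sym eq ; (suc i) → refl }) (p₁ (Vector.tail v))

columnsIndependent? : ∀ {m n} (M : Matrix m n) → Decidable₁ (ColumnsIndependent M)
columnsIndependent? M S = allVectors?
  (λ v≗w p supp ker j →
    trans (sym (v≗w j))
      (p (λ k k∉S → trans (v≗w k) (supp k k∉S))
         (λ i → trans (·-congʳ (M i) v≗w) (ker i)) j))
  (λ c → all? (λ j → ¬? (j ∈? S) →-dec (c j ≟ 0ℙ))
           →-dec all? (λ i → (M *ᵥ c) i ≟ 0ℙ)
           →-dec all? (λ j → c j ≟ 0ℙ))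

subsets : ∀ n → List (Subset n)
subsets zero    = Vec.[] ∷ []
subsets (suc n) =
  map (outside Vec.∷_) (subsets n) ++ map (inside Vec.∷_) (subsets n)

-- The largest number of linearly independent columns; the default value 0 is
-- attained by the empty set of columns.
rank : ∀ {m n} → Matrix m n → ℕ
rank {n = n} M = max 0 (map ∣_∣ (filter (columnsIndependent? M) (subsets n)))

-- Finite simple graphs, with the finite vertex set presented as Fin order.
record Graph (ℓ : Level) : Set (lsuc ℓ) where
  field
    order      : ℕ
    Adjacent   : Rel (Fin order) ℓ
    adjacent?  : Decidable Adjacent
    symmetric  : Symmetric Adjacent
    loopless   : Irreflexive _≡_ Adjacent

open Graph public using (order)

adjacencyMatrix : ∀ {ℓ} (G : Graph ℓ) → Matrix (order G) (order G)
adjacencyMatrix G i j = if does (Graph.adjacent? G i j) then 1ℙ else 0ℙ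

M : ∀ {ℓ} (G : Graph ℓ) → Vector Parity (order G) → Matrix (order G) (order G)
M G ε = adjacencyMatrix G +ᴹ diagonal ε

{-# OPTIONS --safe #-}
-- A symmetric matrix A over 𝔽₂ is reduced by Schur complements, each of which
-- lowers the rank by exactly one.  If A i i = 1, the complement A + (A eᵢ)(A eᵢ)ᵀ
-- is symmetric with diagonal diag A + A eᵢ, and a solution y for it gives the
-- solution x = y + ((A y)ᵢ + 1) eᵢ for A, with (diag A)ᵀ x one more than before.
-- If diag A = 0, then x = 0 and the rank must be even: complements at (i , j) and
-- then (j , i) lead to a symmetric matrix of rank two less, with zero diagonal.
-- By symmetry of A, all solutions x have the same value of (diag A)ᵀ x.
module Submission where

open import Defs
open import Data.Bool.Base using (if_then_else_)
open import Data.Fin.Base using (Fin; zero; suc)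
open import Data.Fin.Properties using (any?) renaming (_≟_ to _≟ᶠ_)
open import Data.Fin.Subset using (Subset; inside; outside; _∉_; ∣_∣; ⊥; _∪_; ⁅_⁆; _-_)
open import Data.Fin.Subset.Properties
  using (∉⊥; ∣⊥∣≡0; nonempty?; Empty-unique; x∈⁅x⁆; x∈⁅y⁆⇒x≡y; p⊂q⇒∣p∣<∣q∣;
         p⊆p∪q; q⊆p∪q; x∈p∪q⁻; p─q⊆p; p─⊥≡p)
open import Data.List.Base using (map; filter)
open import Data.List.Extrema.Nat using (xs≤max; argmax-sel)
open import Data.List.Membership.Propositional using () renaming (_∈_ to _∈ᴸ_)
open import Data.List.Membership.Propositional.Properties
  using (∈-map⁺; ∈-map⁻; ∈-filter⁺; ∈-filter⁻; ∈-++⁺ˡ; ∈-++⁺ʳ)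
open import Data.List.Relation.Unary.All using (lookup)
open import Data.List.Relation.Unary.Any using (here)
open import Data.Maybe.Base using (just; nothing)
open import Data.Nat.Base using (ℕ; zero; suc; _≤_; _<_; s≤s; parity)
open import Data.Nat.Induction using (<-rec)
open import Data.Nat.Properties
  using (_≤?_; ≤-reflexive; ≤-trans; ≤-antisym; n<1+n; m<n⇒m<1+n; m≤n⇒m≤1+n)
-- Data.Parity.Base gives _+_ and _*_ the same precedence.
open import Data.Parity.Base using (Parity; 0ℙ; 1ℙ; _+_)
  renaming (_*_ to infixl 8 _*_)
open import Data.Parity.Properties
  using (_≟_; p+p≡0ℙ; +-identityʳ; *-comm; *-idem; *-zeroʳ; *-identityʳ; +-homo-+;
         +-*-semiring; +-*-commutativeRing)
open import Data.Product using (∃; _×_; _,_)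
open import Data.Sum.Base using (inj₁; inj₂; [_,_]′)
import Data.Vec.Base as Vec
open import Data.Vec.Functional using (Vector; updateAt)
open import Data.Vec.Functional.Properties using (updateAt-updates; updateAt-minimal)
open import Function.Base using (_∘_; const)
open import Function.Bundles using (mk⇔)
open import Level using (Level)
open import Relation.Binary.PropositionalEquality
  using (_≡_; _≢_; _≗_; refl; sym; trans; cong; cong₂; subst; module ≡-Reasoning)
open import Relation.Nullary.Decidable using (yes; no; dec-true; dec-false; does-⇔)
open import Relation.Nullary.Negation using (¬_; contradiction)
open import Tactic.RingSolver using (solve-∀)
open import Tactic.RingSolver.Core.AlmostCommutativeRing
  using (AlmostCommutativeRing; fromCommutativeRing)
open import Algebra.Properties.Semiring.Sum +-*-semiring
  using (sum; sum-cong-≗; sum-replicate-zero; ∑-distrib-+; ∑-comm; *-distribˡ-sum)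

open ≡-Reasoning

-- Arithmetic and bilinear algebra over the two-element field.

private
  variable
    m n : ℕ

-- Deciding zero lets the ring solver use that the characteristic is 2.
parityRing : AlmostCommutativeRing _ _
parityRing = fromCommutativeRing +-*-commutativeRing
  λ { 0ℙ → just refl ; 1ℙ → nothing }

p+q≡0ℙ⇒p≡q : ∀ p q → p + q ≡ 0ℙ → p ≡ q
p+q≡0ℙ⇒p≡q 0ℙ 0ℙ _ = refl
p+q≡0ℙ⇒p≡q 1ℙ 1ℙ _ = refl

p≢1ℙ⇒p≡0ℙ : ∀ {p} → p ≢ 1ℙ → p ≡ 0ℙ
p≢1ℙ⇒p≡0ℙ {0ℙ} _   = refl
p≢1ℙ⇒p≡0ℙ {1ℙ} p≢1 = contradiction refl p≢1

∄1⇒≗0 : {v : Vector Parity n} → ¬ (∃ λ i → v i ≡ 1ℙ) → v ≗ zeroᵥ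
∄1⇒≗0 ∄1 i = p≢1ℙ⇒p≡0ℙ λ vi≡1 → ∄1 (i , vi≡1)

·-comm : (u v : Vector Parity n) → u · v ≡ v · u
·-comm u v = sum-cong-≗ (λ i → *-comm (u i) (v i))

·-zeroʳ : (u : Vector Parity n) → u · zeroᵥ ≡ 0ℙ
·-zeroʳ {n} u = trans (sum-cong-≗ (*-zeroʳ ∘ u)) (sum-replicate-zero n)

-- The single linearity law used below. Coefficients `0ℙ` and `1ℙ` compute away, so its instances
-- also cover plain sums and plain multiples.
·-linear : ∀ (u : Vector Parity n) s t v w →
           u · (λ i → s * v i + t * w i) ≡ s * (u · v) + t * (u · w)
·-linear u s t v w = begin
  u · (λ i → s * v i + t * w i)
    ≡⟨ sum-cong-≗ (λ i → expand s t (u i) (v i) (w i)) ⟩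
  sum (λ i → s * (u i * v i) + t * (u i * w i))
    ≡⟨ ∑-distrib-+ (λ i → s * (u i * v i)) (λ i → t * (u i * w i)) ⟩
  sum (λ i → s * (u i * v i)) + sum (λ i → t * (u i * w i))
    ≡⟨ cong₂ _+_ (*-distribˡ-sum s (λ i → u i * v i)) (*-distribˡ-sum t (λ i → u i * w i)) ⟨
  s * (u · v) + t * (u · w) ∎
  where
  expand : ∀ s t a b c → a * (s * b + t * c) ≡ s * (a * b) + t * (a * c)
  expand = solve-∀ parityRing

basis : Fin n → Vector Parity n
basis j = updateAt zeroᵥ j (const 1ℙ)

·-basis : (u : Vector Parity n) (j : Fin n) → u · basis j ≡ u j
·-basis u zero = begin
  u zero * 1ℙ + (u ∘ suc) · zeroᵥ ≡⟨ cong₂ _+_ (*-identityʳ (u zero)) (·-zeroʳ (u ∘ suc)) ⟩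
  u zero + 0ℙ                     ≡⟨ +-identityʳ (u zero) ⟩
  u zero                          ∎
·-basis u (suc j) = cong₂ _+_ (*-zeroʳ (u zero)) (·-basis (u ∘ suc) j)

Symmetricᴹ : Matrix n n → Set
Symmetricᴹ A = ∀ i j → A i j ≡ A j i

-- Both sides expand to the same double sum once the order of summation is exchanged. This is what
-- later carries the value at one solution over to any other.
·-*ᵥ-symmetric : {A : Matrix n n} → Symmetricᴹ A →
                 ∀ u v → u · (A *ᵥ v) ≡ v · (A *ᵥ u)
·-*ᵥ-symmetric {A = A} A-sym u v = begin
  u · (A *ᵥ v)
    ≡⟨ sum-cong-≗ (λ i → *-distribˡ-sum (u i) (λ j → A i j * v j)) ⟩
  sum (λ i → sum (λ j → u i * (A i j * v j)))
    ≡⟨ ∑-comm (λ i j → u i * (A i j * v j)) ⟩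
  sum (λ j → sum (λ i → u i * (A i j * v j)))
    ≡⟨ sum-cong-≗ (λ j → sum-cong-≗ (λ i →
         trans (cong (λ a → u i * (a * v j)) (A-sym i j)) (swap (u i) (A j i) (v j)))) ⟩
  sum (λ j → sum (λ i → v j * (A j i * u i)))
    ≡⟨ sum-cong-≗ (λ j → *-distribˡ-sum (v j) (λ i → A j i * u i)) ⟨
  v · (A *ᵥ u) ∎
  where
  swap : ∀ a b c → a * (b * c) ≡ c * (b * a)
  swap = solve-∀ parityRing

-- Rank as the size of a largest independent set of columns.

∈-subsets : (S : Subset n) → S ∈ᴸ subsets n
∈-subsets Vec.[]            = here refl
∈-subsets (outside Vec.∷ S) = ∈-++⁺ˡ (∈-map⁺ (outside Vec.∷_) (∈-subsets S))
∈-subsets (inside  Vec.∷ S) =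
  ∈-++⁺ʳ (map (outside Vec.∷_) (subsets _)) (∈-map⁺ (inside Vec.∷_) (∈-subsets S))

independent⇒∣S∣≤rank : (A : Matrix m n) {S : Subset n} →
                       ColumnsIndependent A S → ∣ S ∣ ≤ rank A
independent⇒∣S∣≤rank A {S} ind =
  lookup (xs≤max 0 _) (∈-map⁺ ∣_∣ (∈-filter⁺ (columnsIndependent? A) (∈-subsets S) ind))

rank-attained : (A : Matrix m n) → ∃ λ S → ColumnsIndependent A S × rank A ≡ ∣ S ∣
rank-attained {n = n} A
  with argmax-sel (λ k → k) 0 (map ∣_∣ (filter (columnsIndependent? A) (subsets n)))
-- The default value of `max` was selected. It is realised by the empty set, where the support
-- condition alone makes every coefficient zero.
... | inj₁ rank≡0 = ⊥ , (λ c supp _ j → supp j ∉⊥) , trans rank≡0 (sym (∣⊥∣≡0 n))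
... | inj₂ rank∈ with ∈-map⁻ ∣_∣ rank∈
...   | S , S∈ , eq with ∈-filter⁻ (columnsIndependent? A) {xs = subsets n} S∈
...     | _ , ind = S , ind , eq

-- Otherwise `basis j` would be a nonzero vector supported on `S` and killed by `A`.
zero-column⇒∉ : {A : Matrix m n} {S : Subset n} {j : Fin n} → ColumnsIndependent A S →
                (∀ i → A i j ≡ 0ℙ) → j ∉ S
zero-column⇒∉ {A = A} {j = j} ind column≡0 j∈S = contradiction
  (trans (sym (updateAt-updates j zeroᵥ))
    (ind (basis j)
      (λ k k∉S → updateAt-minimal k j zeroᵥ λ { refl → k∉S j∈S })
      (λ i → trans (·-basis (A i) j) (column≡0 i)) j))
  λ ()

rank-zero : {A : Matrix m n} → (∀ i j → A i j ≡ 0ℙ) → rank A ≡ 0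
rank-zero {n = n} {A} A≡0 with rank-attained A
... | S , ind , rank≡ with nonempty? S
...   | no S-empty = trans rank≡ (trans (cong ∣_∣ (Empty-unique S-empty)) (∣⊥∣≡0 n))
...   | yes (j , j∈S) = contradiction j∈S (zero-column⇒∉ ind λ i → A≡0 i j)

∣p∣≤1+∣p-x∣ : (p : Subset n) (x : Fin n) → ∣ p ∣ ≤ suc ∣ p - x ∣
∣p∣≤1+∣p-x∣ (outside Vec.∷ p) zero    = m≤n⇒m≤1+n (≤-reflexive (cong ∣_∣ (sym (p─⊥≡p p))))
∣p∣≤1+∣p-x∣ (inside  Vec.∷ p) zero    = s≤s (≤-reflexive (cong ∣_∣ (sym (p─⊥≡p p))))
∣p∣≤1+∣p-x∣ (outside Vec.∷ p) (suc x) = ∣p∣≤1+∣p-x∣ p x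
∣p∣≤1+∣p-x∣ (inside  Vec.∷ p) (suc x) = s≤s (∣p∣≤1+∣p-x∣ p x)

x∉p-x : (p : Subset n) (x : Fin n) → x ∉ p - x
x∉p-x (outside Vec.∷ p) zero    ()
x∉p-x (inside  Vec.∷ p) zero    ()
x∉p-x (_       Vec.∷ p) (suc x) (Vec.there x∈) = x∉p-x p x x∈

-- Schur complements and their effect on the rank.

-- The Schur complement at (i , j), for use when A i j ≡ 1ℙ; row i and column j
-- are kept, and vanish in that case.
pivot : Matrix m n → Fin m → Fin n → Matrix m n
pivot A i j k l = A k l + A k j * A i l

pivot-*ᵥ : ∀ (A : Matrix m n) i j x k →
           (pivot A i j *ᵥ x) k ≡ (A *ᵥ x) k + A k j * (A *ᵥ x) i
pivot-*ᵥ A i j x k = begin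
  pivot A i j k · x               ≡⟨ ·-comm _ x ⟩
  x · pivot A i j k               ≡⟨ ·-linear x 1ℙ (A k j) (A k) (A i) ⟩
  x · A k + A k j * (x · A i)
    ≡⟨ cong₂ (λ p q → p + A k j * q) (·-comm x (A k)) (·-comm x (A i)) ⟩
  A k · x + A k j * (A i · x)     ∎

+-basis-*ᵥ : ∀ (A : Matrix m n) x t j i →
             (A *ᵥ (λ l → x l + t * basis j l)) i ≡ (A *ᵥ x) i + t * A i j
+-basis-*ᵥ A x t j i = begin
  A i · (λ l → x l + t * basis j l) ≡⟨ ·-linear (A i) 1ℙ t x (basis j) ⟩
  A i · x + t * (A i · basis j)     ≡⟨ cong (λ p → A i · x + t * p) (·-basis (A i) j) ⟩
  A i · x + t * A i j               ∎

-- Column j can be added to any set of columns independent in the Schur complement.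
rank-pivot-< : ∀ (A : Matrix m n) i j → A i j ≡ 1ℙ → rank (pivot A i j) < rank A
rank-pivot-< A i j Aij≡1 with rank-attained (pivot A i j)
... | S , ind , rank≡ =
  subst (_< rank A) (sym rank≡)
    (≤-trans (p⊂q⇒∣p∣<∣q∣ (p⊆p∪q ⁅ j ⁆ , j , q⊆p∪q S ⁅ j ⁆ (x∈⁅x⁆ j) , j∉S))
             (independent⇒∣S∣≤rank A S∪j-ind))
  where
  pivot-column : ∀ k → pivot A i j k j ≡ 0ℙ
  pivot-column k = begin
    A k j + A k j * A i j ≡⟨ cong (λ p → A k j + A k j * p) Aij≡1 ⟩
    A k j + A k j * 1ℙ    ≡⟨ cong (A k j +_) (*-identityʳ (A k j)) ⟩
    A k j + A k j         ≡⟨ p+p≡0ℙ (A k j) ⟩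
    0ℙ                    ∎

  j∉S : j ∉ S
  j∉S = zero-column⇒∉ ind pivot-column

  S∪j-ind : ColumnsIndependent A (S ∪ ⁅ j ⁆)
  S∪j-ind c supp ker = c≗0
    where
    -- `d` is `c` with coordinate `j` cleared, hence supported on `S`. The complement kills `c`
    -- because `A` does, and it kills `d` because its column `j` is zero.
    d : Vector Parity _
    d k = c k + c j * basis j k

    d-supp : ∀ k → k ∉ S → d k ≡ 0ℙ
    d-supp k k∉S with k ≟ᶠ j
    ... | yes refl = begin
      c j + c j * basis j j ≡⟨ cong (λ p → c j + c j * p) (updateAt-updates j zeroᵥ) ⟩
      c j + c j * 1ℙ        ≡⟨ cong (c j +_) (*-identityʳ (c j)) ⟩
      c j + c j             ≡⟨ p+p≡0ℙ (c j) ⟩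
      0ℙ                    ∎
    ... | no k≢j = begin
      c k + c j * basis j k ≡⟨ cong₂ (λ p q → p + c j * q) ck≡0 (updateAt-minimal k j zeroᵥ k≢j) ⟩
      c j * 0ℙ              ≡⟨ *-zeroʳ (c j) ⟩
      0ℙ                    ∎
      where
      ck≡0 : c k ≡ 0ℙ
      ck≡0 = supp k λ k∈ → [ k∉S , k≢j ∘ x∈⁅y⁆⇒x≡y j ]′ (x∈p∪q⁻ S ⁅ j ⁆ k∈)

    d-ker : pivot A i j *ᵥ d ≗ zeroᵥ
    d-ker k = begin
      (pivot A i j *ᵥ d) k
        ≡⟨ +-basis-*ᵥ (pivot A i j) c (c j) j k ⟩
      (pivot A i j *ᵥ c) k + c j * pivot A i j k j
        ≡⟨ cong₂ (λ p q → p + c j * q) (pivot-*ᵥ A i j c k) (pivot-column k) ⟩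
      (A *ᵥ c) k + A k j * (A *ᵥ c) i + c j * 0ℙ
        ≡⟨ cong₂ (λ p q → p + A k j * q + c j * 0ℙ) (ker k) (ker i) ⟩
      A k j * 0ℙ + c j * 0ℙ
        ≡⟨ cong₂ _+_ (*-zeroʳ (A k j)) (*-zeroʳ (c j)) ⟩
      0ℙ ∎

    c≡cj*basis : ∀ k → c k ≡ c j * basis j k
    c≡cj*basis k = p+q≡0ℙ⇒p≡q _ _ (ind d d-supp d-ker k)

    -- Since `c` is now a multiple of `basis j`, row `i` of `A *ᵥ c` is `c j * A i j`, which is
    -- `c j`.
    cj≡0 : c j ≡ 0ℙ
    cj≡0 = begin
      c j                                ≡⟨ *-identityʳ (c j) ⟨
      c j * 1ℙ                           ≡⟨ cong (c j *_) Aij≡1 ⟨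
      c j * A i j                        ≡⟨ cong (c j *_) (·-basis (A i) j) ⟨
      c j * (A i · basis j)              ≡⟨ ·-linear (A i) 0ℙ (c j) c (basis j) ⟨
      A i · (λ k → c j * basis j k)      ≡⟨ ·-congʳ (A i) c≡cj*basis ⟨
      (A *ᵥ c) i                         ≡⟨ ker i ⟩
      0ℙ                                 ∎

    c≗0 : c ≗ zeroᵥ
    c≗0 k = trans (c≡cj*basis k) (cong (_* basis j k) cj≡0)

-- Exchange: two vectors c and d killed by the Schur complement are mapped by A
-- to multiples t and t′ of its column j, so A kills t′ c + t d.  Hence if S is
-- independent for A and c is nonzero at k ∈ S, then S - k is independent for the
-- Schur complement.
rank-≤-pivot : ∀ (A : Matrix m n) i j → rank A ≤ suc (rank (pivot A i j))
rank-≤-pivot {n = n} A i j with rank-attained A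
-- The bound is decidable, so its failure may be assumed. Under that assumption no kernel vector on
-- `S` can be nonzero, since the exchange would give the bound; so `S` itself is independent for the
-- complement, which gives the bound again.
... | S , ind , rank≡ with ∣ S ∣ ≤? suc (rank (pivot A i j))
...   | yes ∣S∣≤ = subst (_≤ suc (rank (pivot A i j))) (sym rank≡) ∣S∣≤
...   | no ∣S∣≰  =
  contradiction (m≤n⇒m≤1+n (independent⇒∣S∣≤rank (pivot A i j) S-ind)) ∣S∣≰
  where
  image : ∀ c → pivot A i j *ᵥ c ≗ zeroᵥ → ∀ k → (A *ᵥ c) k ≡ A k j * (A *ᵥ c) i
  image c ker k = p+q≡0ℙ⇒p≡q _ _ (trans (sym (pivot-*ᵥ A i j c k)) (ker k))

  module _ (c : Vector Parity n) (supp : ∀ k → k ∉ S → c k ≡ 0ℙ)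
           (ker : pivot A i j *ᵥ c ≗ zeroᵥ) (k : Fin n) (ck≡1 : c k ≡ 1ℙ) where

    S-k-ind : ColumnsIndependent (pivot A i j) (S - k)
    S-k-ind d d-supp d-ker = ind d d-supp-S Ad≗0
      where
      d-supp-S : ∀ l → l ∉ S → d l ≡ 0ℙ
      d-supp-S l l∉S = d-supp l (l∉S ∘ p─q⊆p S ⁅ k ⁆)

      t t′ : Parity
      t  = (A *ᵥ c) i
      t′ = (A *ᵥ d) i

      e : Vector Parity n
      e l = t′ * c l + t * d l

      e≗0 : e ≗ zeroᵥ
      e≗0 = ind e
        (λ l l∉S → begin
          t′ * c l + t * d l ≡⟨ cong₂ (λ p q → t′ * p + t * q) (supp l l∉S) (d-supp-S l l∉S) ⟩
          t′ * 0ℙ + t * 0ℙ   ≡⟨ cong₂ _+_ (*-zeroʳ t′) (*-zeroʳ t) ⟩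
          0ℙ                 ∎)
        (λ l → begin
          A l · e                                  ≡⟨ ·-linear (A l) t′ t c d ⟩
          t′ * (A l · c) + t * (A l · d)
            ≡⟨ cong₂ (λ p q → t′ * p + t * q) (image c ker l) (image d d-ker l) ⟩
          t′ * (A l j * t) + t * (A l j * t′)      ≡⟨ cancel t t′ (A l j) ⟩
          0ℙ                                       ∎)
        where
        cancel : ∀ p q r → q * (r * p) + p * (r * q) ≡ 0ℙ
        cancel = solve-∀ parityRing

      -- Evaluate `e` at `k`, where `c` is 1 and `d` is 0.
      t′≡0 : t′ ≡ 0ℙ
      t′≡0 = begin
        t′                 ≡⟨ simplify t t′ ⟩
        t′ * 1ℙ + t * 0ℙ   ≡⟨ cong₂ (λ p q → t′ * p + t * q) ck≡1 (d-supp k (x∉p-x S k)) ⟨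
        e k                ≡⟨ e≗0 k ⟩
        0ℙ                 ∎
        where
        simplify : ∀ p q → q ≡ q * 1ℙ + p * 0ℙ
        simplify = solve-∀ parityRing

      Ad≗0 : A *ᵥ d ≗ zeroᵥ
      Ad≗0 l = trans (image d d-ker l) (trans (cong (A l j *_) t′≡0) (*-zeroʳ (A l j)))

  S-ind : ColumnsIndependent (pivot A i j) S
  S-ind c supp ker k = p≢1ℙ⇒p≡0ℙ λ ck≡1 → ∣S∣≰
    (≤-trans (∣p∣≤1+∣p-x∣ S k)
      (s≤s (independent⇒∣S∣≤rank (pivot A i j) (S-k-ind c supp ker k ck≡1))))

rank-pivot : ∀ (A : Matrix m n) i j → A i j ≡ 1ℙ → rank A ≡ suc (rank (pivot A i j))
rank-pivot A i j Aij≡1 = ≤-antisym (rank-≤-pivot A i j) (rank-pivot-< A i j Aij≡1)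

-- Symmetric matrices with their diagonal as right-hand side.

mainDiagonal : Matrix n n → Vector Parity n
mainDiagonal A i = A i i

-- Taking the diagonal of the matrix itself as right-hand side frees the claim from graphs, so that
-- it can be passed to Schur complements.
DiagonalSolution : Matrix n n → Set
DiagonalSolution A = ∃ λ x →
  A *ᵥ x ≗ mainDiagonal A × mainDiagonal A · x ≡ parity (rank A)

module _ {A : Matrix n n} (A-sym : Symmetricᴹ A) where

  pivot-diagonal-symmetric : ∀ i → Symmetricᴹ (pivot A i i)
  pivot-diagonal-symmetric i k l = cong₂ _+_ (A-sym k l)
    (trans (cong₂ _*_ (A-sym k i) (A-sym i l)) (*-comm (A i k) (A l i)))

  -- The correction `A k i * A i k` is a square by symmetry, and every element of the field is its
  -- own square.
  pivot-mainDiagonal : ∀ i k → pivot A i i k k ≡ A k k + A k i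
  pivot-mainDiagonal i k =
    cong (A k k +_) (trans (cong (A k i *_) (A-sym i k)) (*-idem (A k i)))

  diagonalSolution-lift : ∀ i → A i i ≡ 1ℙ →
                          DiagonalSolution (pivot A i i) → DiagonalSolution A
  diagonalSolution-lift i Aii≡1 (y , solves , value) = x , x-solves , x-value
    where
    ε : Vector Parity n
    ε = mainDiagonal A

    t : Parity
    t = (A *ᵥ y) i

    -- `solves` reads A y + t (A eᵢ) = ε + A eᵢ. Collecting the multiples of column `i` on the left
    -- gives the coefficient `t + 1ℙ`.
    x : Vector Parity n
    x l = y l + (t + 1ℙ) * basis i l

    x-solves : A *ᵥ x ≗ ε
    x-solves k = begin
      (A *ᵥ x) k                               ≡⟨ +-basis-*ᵥ A y (t + 1ℙ) i k ⟩
      (A *ᵥ y) k + (t + 1ℙ) * A k i            ≡⟨ regroup ((A *ᵥ y) k) t (A k i) ⟩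
      ((A *ᵥ y) k + A k i * t) + A k i         ≡⟨ cong (_+ A k i) (pivot-*ᵥ A i i y k) ⟨
      (pivot A i i *ᵥ y) k + A k i
        ≡⟨ cong (_+ A k i) (trans (solves k) (pivot-mainDiagonal i k)) ⟩
      ε k + A k i + A k i                      ≡⟨ cancel (ε k) (A k i) ⟩
      ε k                                      ∎
      where
      regroup : ∀ p q r → p + (q + 1ℙ) * r ≡ (p + r * q) + r
      regroup = solve-∀ parityRing
      cancel : ∀ p q → p + q + q ≡ p
      cancel = solve-∀ parityRing

    -- By symmetry column `i` is row `i`, so the change of the diagonal contributes exactly `t`.
    y-value : mainDiagonal (pivot A i i) · y ≡ ε · y + t
    y-value = begin
      mainDiagonal (pivot A i i) · y   ≡⟨ ·-comm _ y ⟩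
      y · mainDiagonal (pivot A i i)
        ≡⟨ ·-congʳ y (λ k → trans (pivot-mainDiagonal i k) (cong (ε k +_) (A-sym k i))) ⟩
      y · (λ k → ε k + A i k)          ≡⟨ ·-linear y 1ℙ 1ℙ ε (A i) ⟩
      y · ε + y · A i                  ≡⟨ cong₂ _+_ (·-comm y ε) (·-comm y (A i)) ⟩
      ε · y + t                        ∎

    x-value : ε · x ≡ parity (rank A)
    x-value = begin
      ε · x                                    ≡⟨ ·-linear ε 1ℙ (t + 1ℙ) y (basis i) ⟩
      ε · y + (t + 1ℙ) * (ε · basis i)
        ≡⟨ cong (λ p → ε · y + (t + 1ℙ) * p) (trans (·-basis ε i) Aii≡1) ⟩
      ε · y + (t + 1ℙ) * 1ℙ                    ≡⟨ regroup (ε · y) t ⟩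
      1ℙ + (ε · y + t)                         ≡⟨ cong (1ℙ +_) (trans (sym y-value) value) ⟩
      1ℙ + parity (rank (pivot A i i))         ≡⟨ +-homo-+ 1 (rank (pivot A i i)) ⟨
      parity (suc (rank (pivot A i i)))        ≡⟨ cong parity (rank-pivot A i i Aii≡1) ⟨
      parity (rank A)                          ∎
      where
      regroup : ∀ p q → p + (q + 1ℙ) * 1ℙ ≡ 1ℙ + (p + q)
      regroup = solve-∀ parityRing

  module _ (A-diagonal : mainDiagonal A ≗ zeroᵥ) (i j : Fin n) where

    -- When `A i j` is 1, this eliminates the block of `A` on rows and columns `i`, `j`, a
    -- hyperbolic plane. The second complement, at the transposed position, restores the symmetry
    -- that the first may break.
    pivot₂ : Matrix n n
    pivot₂ = pivot (pivot A i j) j i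

    -- Because `A i i` and `A j j` vanish, the first complement leaves column `i` and row `j`
    -- unchanged.
    pivot₂-entry : ∀ k l → pivot₂ k l ≡ A k l + A k j * A i l + A k i * A j l
    pivot₂-entry k l = begin
      A k l + A k j * A i l + (A k i + A k j * A i i) * (A j l + A j j * A i l)
        ≡⟨ cong₂ (λ p q → A k l + A k j * A i l + (A k i + A k j * p) * (A j l + q * A i l))
             (A-diagonal i) (A-diagonal j) ⟩
      A k l + A k j * A i l + (A k i + A k j * 0ℙ) * (A j l + 0ℙ * A i l)
        ≡⟨ simplify (A k l) (A k j) (A i l) (A k i) (A j l) ⟩
      A k l + A k j * A i l + A k i * A j l ∎
      where
      simplify : ∀ p q r s t →
                 p + q * r + (s + q * 0ℙ) * (t + 0ℙ * r) ≡ p + q * r + s * t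
      simplify = solve-∀ parityRing

    pivot₂-symmetric : Symmetricᴹ pivot₂
    pivot₂-symmetric k l = begin
      pivot₂ k l                              ≡⟨ pivot₂-entry k l ⟩
      A k l + A k j * A i l + A k i * A j l
        ≡⟨ cong₂ _+_ (cong₂ _+_ (A-sym k l) (cong₂ _*_ (A-sym k j) (A-sym i l)))
                     (cong₂ _*_ (A-sym k i) (A-sym j l)) ⟩
      A l k + A j k * A l i + A i k * A l j   ≡⟨ swap (A l k) (A j k) (A l i) (A i k) (A l j) ⟩
      A l k + A l j * A i k + A l i * A j k   ≡⟨ pivot₂-entry l k ⟨
      pivot₂ l k                              ∎
      where
      swap : ∀ p q r s t → p + q * r + s * t ≡ p + t * s + r * q
      swap = solve-∀ parityRing

    -- By symmetry the two corrections at `(k , k)` are equal, so they cancel in characteristic 2.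
    pivot₂-mainDiagonal : mainDiagonal pivot₂ ≗ zeroᵥ
    pivot₂-mainDiagonal k = begin
      pivot₂ k k                              ≡⟨ pivot₂-entry k k ⟩
      A k k + A k j * A i k + A k i * A j k
        ≡⟨ cong₂ _+_ (cong₂ _+_ (A-diagonal k) (cong (A k j *_) (A-sym i k)))
                     (cong (A k i *_) (A-sym j k)) ⟩
      0ℙ + A k j * A k i + A k i * A k j      ≡⟨ cancel (A k j) (A k i) ⟩
      0ℙ                                      ∎
      where
      cancel : ∀ p q → 0ℙ + p * q + q * p ≡ 0ℙ
      cancel = solve-∀ parityRing

    rank-pivot₂ : A i j ≡ 1ℙ → rank A ≡ suc (suc (rank pivot₂))
    rank-pivot₂ Aij≡1 = trans (rank-pivot A i j Aij≡1)
      (cong suc (rank-pivot (pivot A i j) j i (begin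
        -- The second pivot entry is still 1, since the zero diagonal removes its correction.
        A j i + A j j * A i i ≡⟨ cong₂ _+_ (trans (A-sym j i) Aij≡1) (cong (_* A i i) (A-diagonal j)) ⟩
        1ℙ                    ∎)))

  diagonalSolution-zero : mainDiagonal A ≗ zeroᵥ → parity (rank A) ≡ 0ℙ → DiagonalSolution A
  diagonalSolution-zero A-diagonal even =
    zeroᵥ
    , (λ k → trans (·-zeroʳ (A k)) (sym (A-diagonal k)))
    , trans (·-zeroʳ (mainDiagonal A)) (sym even)

-- Strong induction on the rank.

diagonalSolution : ∀ {A : Matrix n n} → Symmetricᴹ A → DiagonalSolution A
diagonalSolution {n} A-sym = <-rec P step _ _ A-sym refl
  where
  -- Complements keep the size of the matrix, so `n` stays fixed while the rank falls.
  P : ℕ → Set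
  P r = ∀ (A : Matrix n n) → Symmetricᴹ A → rank A ≡ r → DiagonalSolution A

  step : ∀ r → (∀ {s} → s < r → P s) → P r
  step _ rec A A-sym refl with any? (λ i → A i i ≟ 1ℙ)
  ... | yes (i , Aii≡1) = diagonalSolution-lift A-sym i Aii≡1
    (rec (rank-pivot-< A i i Aii≡1) _ (pivot-diagonal-symmetric A-sym i) refl)
  ... | no diagonal≢1 with any? (λ i → any? (λ j → A i j ≟ 1ℙ))
  ...   | no A≢1 = diagonalSolution-zero A-sym (∄1⇒≗0 diagonal≢1)
    (cong parity (rank-zero λ i j → p≢1ℙ⇒p≡0ℙ λ Aij≡1 → A≢1 (i , j , Aij≡1)))
  ...   | yes (i , j , Aij≡1) = diagonalSolution-zero A-sym A-diagonal even
    where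
    A-diagonal : mainDiagonal A ≗ zeroᵥ
    A-diagonal = ∄1⇒≗0 diagonal≢1

    A₂ : Matrix n n
    A₂ = pivot₂ A-sym A-diagonal i j

    rank≡ : rank A ≡ suc (suc (rank A₂))
    rank≡ = rank-pivot₂ A-sym A-diagonal i j Aij≡1

    -- The induction hypothesis serves only to find a parity: `A₂` has zero diagonal, so whatever
    -- `y` is, the value is 0 and `rank A₂` is even. The two further units of rank disappear as
    -- `parity` computes.
    even : parity (rank A) ≡ 0ℙ
    even with rec (subst (rank A₂ <_) (sym rank≡) (m<n⇒m<1+n (n<1+n _)))
                  A₂ (pivot₂-symmetric A-sym A-diagonal i j) refl
    ... | y , _ , value = begin
      parity (rank A)          ≡⟨ cong parity rank≡ ⟩
      parity (rank A₂)         ≡⟨ value ⟨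
      mainDiagonal A₂ · y      ≡⟨ ·-comm _ y ⟩
      y · mainDiagonal A₂      ≡⟨ ·-congʳ y (pivot₂-mainDiagonal A-sym A-diagonal i j) ⟩
      y · zeroᵥ                ≡⟨ ·-zeroʳ y ⟩
      0ℙ                       ∎

-- Application to graphs.

M-symmetric : ∀ {ℓ} (G : Graph ℓ) ε → Symmetricᴹ (M G ε)
M-symmetric G ε i j = cong₂ _+_ (adjacency-sym i j) (diagonal-sym i j)
  where
  adjacency-sym : Symmetricᴹ (adjacencyMatrix G)
  adjacency-sym i j = cong (if_then 1ℙ else 0ℙ)
    (does-⇔ (mk⇔ (Graph.symmetric G) (Graph.symmetric G))
            (Graph.adjacent? G i j) (Graph.adjacent? G j i))

  diagonal-sym : Symmetricᴹ (diagonal ε)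
  diagonal-sym i j with i ≟ᶠ j | j ≟ᶠ i
  ... | yes refl | yes _   = refl
  ... | yes refl | no i≢i  = contradiction refl i≢i
  ... | no i≢i   | yes refl = contradiction refl i≢i
  ... | no _     | no _    = refl

M-mainDiagonal : ∀ {ℓ} (G : Graph ℓ) ε → mainDiagonal (M G ε) ≗ ε
M-mainDiagonal G ε i = cong₂ (λ a d → (if a then 1ℙ else 0ℙ) + (if d then ε i else 0ℙ))
  (dec-false (Graph.adjacent? G i i) (Graph.loopless G refl))
  (dec-true (i ≟ᶠ i) refl)

corollary1p2 : ∀ {ℓ : Level} (G : Graph ℓ) (ε : Vector Parity (order G)) →
    (∃ λ (x : Vector Parity (order G)) → M G ε *ᵥ x ≗ ε)
    × (∀ (x : Vector Parity (order G)) → M G ε *ᵥ x ≗ ε →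
    ε · x ≡ parity (rank (M G ε)))
corollary1p2 G ε with diagonalSolution (M-symmetric G ε)
... | y , solves , value = (y , Ay≗ε) , λ x Ax≗ε → begin
  ε · x                          ≡⟨ ·-comm ε x ⟩
  x · ε                          ≡⟨ ·-congʳ x Ay≗ε ⟨
  -- Here `x` and `y` trade places: ε was replaced by the image of `y`, and the image of `x` becomes
  -- ε again.
  x · (M G ε *ᵥ y)               ≡⟨ ·-*ᵥ-symmetric (M-symmetric G ε) x y ⟩
  y · (M G ε *ᵥ x)               ≡⟨ ·-congʳ y Ax≗ε ⟩
  y · ε                          ≡⟨ ·-congʳ y (M-mainDiagonal G ε) ⟨
  y · mainDiagonal (M G ε)       ≡⟨ ·-comm y _ ⟩
  mainDiagonal (M G ε) · y       ≡⟨ value ⟩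
  parity (rank (M G ε))          ∎
  where
  Ay≗ε : M G ε *ᵥ y ≗ ε
  Ay≗ε i = trans (solves i) (M-mainDiagonal G ε i)
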